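{- The algorithm Encode_SiP.to.RPG for encoding a self-inverting permutation $\pi^*$ of length $n^*$ as a reducible permutation flow-graph $F[\pi^*]$ requires $O(n^*)$ time and space.
   Context: A permutation $\pi=(\pi_1,\ldots,\pi_{m})$ over $\{1,\ldots,m\}$ is self-inverting if $\pi_{\pi_i}=i$ for all $i$; its length is $m$. Let $\pi^{ -1}_i$ denote the position of $i$ in the sequence $\pi$. Domination: an element $i$ of $\pi$ dominates $j$ if $i>j$ and $\pi^{ -1}_i<\pi^{ -1}_j$; $i$ directly dominates (d-dominates) $j$ if $i$ dominates $j$ and there is no $k$ in $\pi$ such that $i$ dominates $k$ and $k$ dominates $j$. $dmax(j)$ is the maximum of the elements of $\pi$ that d-dominate $j$; if no element of $\pi$ dominates $j$, then $dmax(j)=m+1$ (the dummy element $s=m+1$ is regarded as placed before all elements of $\pi$ and dominating all of them). A flow-graph is a directed graph with a source node $s$ from which all other nodes are reachable. A node $y$ is an entry of a subgraph $H$ if there is an edge $(x,y)$ with $y\in H$, $x\notin H$. A flow-graph is reducible if it has no strongly connected subgraph with two or more entries. The reducible permutation flow-graph $F[\pi^*]$ of a self-inverting permutation $\pi^*$ of length $n^*$ is a reducible flow-graph on $n^*+2$ nodes $s=u_{n^*+1},u_{n^*},\ldots,u_1,u_0=t$, where the header $s$ is the source and has outdegree 1, the footer $t$ has outdegree 0 and is reachable from all nodes, and each body node $u_i$, $1\le i\le n^*$, has exactly two outgoing edges, one to $u_{i-1}$ and one to a node $u_m$ with $m>i$. Algorithm Encode_SiP.to.RPG (input: self-inverting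 permutation $\pi^*$ of length $n^*$; output: $F[\pi^*]$): 1. For each element $i\in\pi^*$, $1\le i\le n^*$, compute $P(i)=dmax(i)$. 2. Construct a directed graph $F[\pi^*]$ with vertex set $\{s=u_{n^*+1},u_{n^*},\ldots,u_1,u_0=t\}$ and the forward edges $(u_{i+1},u_i)$, $0\le i\le n^*$. 3. For each $1\le i\le n^*$ add the backward edge $(u_i,u_m)$ where $m=P(i)$. 4. Return $F[\pi^*]$. The algorithm may compute the values $dmax(i)$ in Step 1 by any procedure. Time and space are counted in the usual unit-cost RAM sense.
   Formalization: An entry of a subgraph H is taken to be a node where a path from the source first meets H, not the head of any edge from outside H; with the literal definition F[π*] is not reducible for π* = (3,2,1). The time and space claim is unaffected. -}

module Defs where

open import Level using (0ℓ)
open import Data.Bool.Base using (if_then_else_)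
open import Data.Nat.Base using (ℕ; suc; _+_; _*_; _∸_; _≤_)
import Data.Nat.Properties as ℕ
open import Data.Fin.Base using (Fin; zero; suc; toℕ; fromℕ; inject₁)
import Data.Fin.Base as Fin
open import Data.Fin.Permutation using (Permutation′; _⟨$⟩ʳ_; _⟨$⟩ˡ_)
open import Data.Fin.Subset using (Subset; _∈_; _∉_)
open import Data.List.Base using (List; []; _∷_; _++_; [_]; map; concat; length; upTo; deduplicate)
open import Data.List.Membership.Propositional renaming (_∈_ to _∈ˡ_) using ()
open import Data.List.Relation.Unary.Unique.Propositional using (Unique)
open import Data.Product.Base using (∃-syntax; ∃₂; _×_; _,_)
open import Data.Sum.Base using (_⊎_)
open import Function.Bundles using (_⇔_)
open import Relation.Binary.Core using (Rel)
open import Relation.Binary.Definitions using (DecidableEquality)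
open import Relation.Binary.Construct.Closure.ReflexiveTransitive using (Star)
open import Relation.Binary.PropositionalEquality using (_≡_; _≢_; refl; cong)
open import Relation.Nullary using (¬_; does; yes; no)
open import Relation.Nullary.Decidable using (map′; _×-dec_)

------------------------------------------------------------------------
-- Self-inverting permutations and domination
--
-- The element i ∈ {1,…,n} of the sequence π = (π₁,…,πₙ), and likewise the
-- position i, is represented by the i′ : Fin n with suc (toℕ i′) = i.
-- Thus  π ⟨$⟩ʳ p  is the element at position p and  π ⟨$⟩ˡ i  the
-- position of the element i.

SelfInverting : ∀ {n} → Permutation′ n → Set
SelfInverting π = ∀ i → π ⟨$⟩ʳ (π ⟨$⟩ʳ i) ≡ i

Dominates : ∀ {n} → Permutation′ n → Rel (Fin n) 0ℓ
Dominates π i j = (i Fin.> j) × (π ⟨$⟩ˡ i) Fin.< (π ⟨$⟩ˡ j)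

DDominates : ∀ {n} → Permutation′ n → Rel (Fin n) 0ℓ
DDominates π i j = Dominates π i j × ¬ (∃[ k ] Dominates π i k × Dominates π k j)

------------------------------------------------------------------------
-- Nodes: the node uₖ, 0 ≤ k ≤ n + 1, is the element of Fin (2 + n) with
-- value k.

Node : ℕ → Set
Node n = Fin (2 + n)

header : ∀ {n} → Node n
header {n} = fromℕ (suc n)

footer : ∀ {n} → Node n
footer = zero

body : ∀ {n} → Fin n → Node n
body i = suc (inject₁ i)

below-body : ∀ {n} → Fin n → Node n
below-body i = inject₁ (inject₁ i)

-- DMax π j m : "dmax(j) = m".  An element and the body node with the same
-- number are identified; header = n + 1 is the dummy element.
data DMax {n} (π : Permutation′ n) (j : Fin n) : Node n → Set where
  greatest : ∀ {i} → DDominates π i j →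
             (∀ k → DDominates π k j → k Fin.≤ i) →
             DMax π j (body i)
  dummy    : (∀ i → ¬ Dominates π i j) → DMax π j header

data F[_] {n} (π : Permutation′ n) : Rel (Node n) 0ℓ where
  forward  : (i : Fin (suc n)) → F[ π ] (suc i) (inject₁ i)
  backward : (i : Fin n) {m : Node n} → DMax π i m → F[ π ] (body i) m

------------------------------------------------------------------------
-- Reducible permutation flow-graphs

-- A directed graph is given by its edge relation E; subgraphs are induced
-- subgraphs, which loses nothing for strong connectivity and entries.
StronglyConnected : ∀ {k} → Rel (Fin k) 0ℓ → Subset k → Set
StronglyConnected E H =
  ∀ x y → x ∈ H → y ∈ H → Star (λ a b → a ∈ H × b ∈ H × E a b) x y

-- Entry s E H y : a path from the source s reaches H for the first time
-- at y (every step of the path leaves a node outside H).  The edge (x,y)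
-- by which H is entered must thus be reachable from s without passing
-- through H.  Dropping this requirement, so that any edge from outside H
-- into y counts, would make the outer loop of two nested loops with
-- different headers irreducible: for π = (3,2,1) the subgraph {u₃,u₂}
-- would have the two entries u₃ (from s) and u₂ (from u₁).
Entry : ∀ {k} → Fin k → Rel (Fin k) 0ℓ → Subset k → Fin k → Set
Entry s E H y = y ∈ H × Star (λ a b → a ∉ H × E a b) s y

Reducible : ∀ {k} → Fin k → Rel (Fin k) 0ℓ → Set
Reducible s E =
  ¬ (∃[ H ] StronglyConnected E H ×
     ∃₂ λ y y′ → y ≢ y′ × Entry s E H y × Entry s E H y′)

record IsReduciblePermutationFlowGraph {n} (E : Rel (Node n) 0ℓ) : Set where
  field
    source         : ∀ v → Star E header v
    reducible      : Reducible header E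
    header-degree  : ∃[ w ] E header w × (∀ w′ → E header w′ → w ≡ w′)
    footer-degree  : ∀ w → ¬ E footer w
    footer-reached : ∀ v → Star E v footer
    body-degree    : ∀ (i : Fin n) → ∃[ m ] body i Fin.< m ×
                     (∀ w → E (body i) w ⇔ (w ≡ below-body i ⊎ w ≡ m))

------------------------------------------------------------------------
-- A unit-cost random access machine, with structured control flow
--
-- The memory consists of scalar registers and of arrays, both named by
-- constants occurring in the program; only array offsets are computed at
-- run time, so one program uses a fixed number of registers and arrays.

data Cell : Set where
  reg : (r : ℕ)   → Cell
  arr : (a i : ℕ) → Cell

infix 4 _≟_
_≟_ : DecidableEquality Cell
reg r   ≟ reg s   = map′ (cong reg) (λ { refl → refl }) (r ℕ.≟ s)
reg _   ≟ arr _ _ = no λ ()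
arr _ _ ≟ reg _   = no λ ()
arr a i ≟ arr b j = map′ (λ { (refl , refl) → refl }) (λ { refl → refl , refl })
                         ((a ℕ.≟ b) ×-dec (i ℕ.≟ j))

Store : Set
Store = Cell → ℕ

update : Store → Cell → ℕ → Store
update σ c v d = if does (c ≟ d) then v else σ d

data Instr : Set where
  const : (r k : ℕ)   → Instr    -- r ≔ k
  copy  : (r s : ℕ)   → Instr    -- r ≔ s
  add   : (r s t : ℕ) → Instr    -- r ≔ s + t
  sub   : (r s t : ℕ) → Instr    -- r ≔ s ∸ t
  load  : (r a s : ℕ) → Instr    -- r ≔ a[s]
  store : (a s r : ℕ) → Instr    -- a[s] ≔ r

infixr 5 _⨾_
data Program : Set where
  instr : Instr → Program
  _⨾_   : Program → Program → Program
  if    : (r : ℕ) → Program → Program → Program    -- if r ≠ 0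
  while : (r : ℕ) → Program → Program              -- while r ≠ 0

apply : Instr → Store → Store
apply (const r k)   σ = update σ (reg r) k
apply (copy r s)    σ = update σ (reg r) (σ (reg s))
apply (add r s t)   σ = update σ (reg r) (σ (reg s) + σ (reg t))
apply (sub r s t)   σ = update σ (reg r) (σ (reg s) ∸ σ (reg t))
apply (load r a s)  σ = update σ (reg r) (σ (arr a (σ (reg s))))
apply (store a s r) σ = update σ (arr a (σ (reg s))) (σ (reg r))

accessed : Instr → Store → List Cell
accessed (const r k)   σ = reg r ∷ []
accessed (copy r s)    σ = reg r ∷ reg s ∷ []
accessed (add r s t)   σ = reg r ∷ reg s ∷ reg t ∷ []
accessed (sub r s t)   σ = reg r ∷ reg s ∷ reg t ∷ []
accessed (load r a s)  σ = reg r ∷ reg s ∷ arr a (σ (reg s)) ∷ []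
accessed (store a s r) σ = reg s ∷ reg r ∷ arr a (σ (reg s)) ∷ []

-- One entry for each executed instruction and each evaluated test,
-- listing the cells accessed.
Trace : Set
Trace = List (List Cell)

-- Run p σ τ σ′ : started in σ, the program p halts in σ′ with trace τ.
data Run : Program → Store → Trace → Store → Set where
  instr      : ∀ {c σ} → Run (instr c) σ [ accessed c σ ] (apply c σ)
  _⨾_        : ∀ {p q σ₀ σ₁ σ₂ τ₁ τ₂} →
               Run p σ₀ τ₁ σ₁ → Run q σ₁ τ₂ σ₂ → Run (p ⨾ q) σ₀ (τ₁ ++ τ₂) σ₂
  if-true    : ∀ {r p q σ τ σ′} → σ (reg r) ≢ 0 →
               Run p σ τ σ′ → Run (if r p q) σ ([ reg r ] ∷ τ) σ′
  if-false   : ∀ {r p q σ τ σ′} → σ (reg r) ≡ 0 →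
               Run q σ τ σ′ → Run (if r p q) σ ([ reg r ] ∷ τ) σ′
  while-true : ∀ {r p σ₀ σ₁ σ₂ τ₁ τ₂} → σ₀ (reg r) ≢ 0 →
               Run p σ₀ τ₁ σ₁ → Run (while r p) σ₁ τ₂ σ₂ →
               Run (while r p) σ₀ ([ reg r ] ∷ τ₁ ++ τ₂) σ₂
  while-false : ∀ {r p σ} → σ (reg r) ≡ 0 →
               Run (while r p) σ [ [ reg r ] ] σ

timeOf : Trace → ℕ
timeOf = length

-- Number of distinct memory cells accessed.
spaceOf : Trace → ℕ
spaceOf τ = length (deduplicate _≟_ (concat τ))

infix 4 _∈O_
_∈O_ : (ℕ → ℕ) → (ℕ → ℕ) → Set
f ∈O g = ∃₂ λ c n₀ → ∀ n → n₀ ≤ n → f n ≤ c * g n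

------------------------------------------------------------------------
-- The data of the algorithm in memory

-- Registers
pattern rLength = 0    -- n
pattern rNodes  = 1    -- number of nodes of the graph
pattern rEdges  = 2    -- number of edges of the graph
pattern rI      = 3
pattern rJ      = 4
pattern rOne    = 5

-- Arrays
pattern aπ      = 0    -- π₁,…,πₙ at offsets 1,…,n
pattern aP      = 1    -- P(1),…,P(n) at offsets 1,…,n
pattern aSource = 2    -- the edges are (aSource[e], aTarget[e]), e < rEdges
pattern aTarget = 3

StoresPermutation : ∀ {n} → Permutation′ n → Store → Set
StoresPermutation {n} π σ =
  σ (reg rLength) ≡ n ×
  (∀ p → σ (arr aπ (suc (toℕ p))) ≡ suc (toℕ (π ⟨$⟩ʳ p)))

StoresDMax : ∀ {n} → Permutation′ n → Store → Set
StoresDMax {n} π σ =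
  σ (reg rLength) ≡ n ×
  (∀ i → ∃[ m ] DMax π i m × σ (arr aP (suc (toℕ i))) ≡ toℕ m)

edgeList : Store → List (ℕ × ℕ)
edgeList σ = map (λ e → σ (arr aSource e) , σ (arr aTarget e)) (upTo (σ (reg rEdges)))

record StoresGraph {k} (E : Rel (Fin k) 0ℓ) (σ : Store) : Set where
  field
    nodes    : σ (reg rNodes) ≡ k
    unique   : Unique (edgeList σ)
    sound    : ∀ {x y} → (x , y) ∈ˡ edgeList σ →
               ∃₂ λ v w → toℕ v ≡ x × toℕ w ≡ y × E v w
    complete : ∀ {v w} → E v w → (toℕ v , toℕ w) ∈ˡ edgeList σ

------------------------------------------------------------------------
-- The encoding algorithm

-- Append the edge (r,s) to the edge list; rOne must contain 1.
addEdge : (r s : ℕ) → Program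
addEdge r s =
  instr (store aSource rEdges r) ⨾
  instr (store aTarget rEdges s) ⨾
  instr (add rEdges rEdges rOne)

-- The nodes and, for i = n + 1,…,1, the forward edges (uᵢ , uᵢ₋₁).
step₂ : Program
step₂ =
  instr (const rOne 1) ⨾
  instr (add rI rLength rOne) ⨾
  instr (add rNodes rI rOne) ⨾
  instr (const rEdges 0) ⨾
  while rI
    ( instr (sub rJ rI rOne) ⨾
      addEdge rI rJ ⨾
      instr (copy rI rJ) )

-- For i = n,…,1, the backward edge (uᵢ , uₘ) with m = P(i).
step₃ : Program
step₃ =
  instr (copy rI rLength) ⨾
  while rI
    ( instr (load rJ aP rI) ⨾
      addEdge rI rJ ⨾
      instr (sub rI rI rOne) )

-- The procedure computing P(i) = dmax(i) is left open.
encode-SiP-to-RPG : (step₁ : Program) → Program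
encode-SiP-to-RPG step₁ = step₁ ⨾ step₂ ⨾ step₃

{-# OPTIONS --safe #-}

-- dmax(j) is the nearest element to the left of j that is greater than j:
-- reading leftwards from j, the d-dominators of j are the successive minima
-- of its dominators, so the greatest of them is the one met first.  All dmax
-- values are therefore found by one left-to-right scan with a stack, and the
-- stack needs no memory of its own, since below an element x it continues
-- with P(x).  Every element is pushed once and popped at most once, so the
-- scan is linear.
--
-- The graph is reducible because its edges lower the index of a node by at
-- most one: a path from the header passes through all nodes above its
-- endpoint, so a set of nodes can be entered only at its highest node.

module Submission where

open import Defs
open import Data.Nat.Base
  using (ℕ; zero; suc; _+_; _*_; _∸_; _≤_; _<_; z≤n; s≤s; s≤s⁻¹)
import Data.Nat.Properties as ℕ
open import Data.Nat.Tactic.RingSolver using (solve-∀)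
open import Data.Fin.Base using (Fin; zero; suc; toℕ; fromℕ; fromℕ<; inject₁)
import Data.Fin.Base as Fin
open import Data.Fin.Properties
  using (toℕ-injective; toℕ-inject₁; toℕ-fromℕ; toℕ-fromℕ<; toℕ<n)
open import Data.Fin.Permutation
  using (Permutation′; _⟨$⟩ʳ_; _⟨$⟩ˡ_; inverseˡ; inverseʳ)
open import Data.Fin.Subset using (Subset; _∉_)
open import Data.List.Base
  using (List; []; _∷_; _++_; [_]; map; concat; length; upTo; downFrom)
open import Data.List.Properties
  using (length-++; length-deduplicate; map-++; map-cong-local;
         upTo-∷ʳ; ++-assoc; ++-identityʳ)
open import Data.List.Membership.Propositional renaming (_∈_ to _∈ˡ_) using ()
open import Data.List.Membership.Propositional.Properties
  using (∈-map⁺; ∈-map⁻; ∈-++⁺ˡ; ∈-++⁺ʳ; ∈-++⁻; ∈-downFrom⁺; ∈-downFrom⁻)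
open import Data.List.Relation.Unary.All using (All; []; _∷_)
open import Data.List.Relation.Unary.All.Properties using (all-upTo; ++⁺)
open import Data.List.Relation.Unary.Unique.Propositional using (Unique)
import Data.List.Relation.Unary.Unique.Propositional.Properties as Unique
import Data.List.Relation.Unary.All as All
open import Data.Maybe.Base using (Maybe; just; nothing)
open import Data.Product.Base
  using (∃-syntax; ∃₂; _×_; _,_; proj₁; proj₂)
open import Data.Sum.Base using (_⊎_; inj₁; inj₂)
open import Function.Base using (_∘_)
open import Function.Bundles using (mk⇔)
open import Relation.Binary.Definitions using (tri<; tri≈; tri>)
open import Relation.Binary.Construct.Closure.ReflexiveTransitive
  using (Star; ε; _◅_)
open import Relation.Binary.PropositionalEquality
  using (_≡_; _≢_; refl; sym; trans; cong; cong₂; subst; subst₂; module ≡-Reasoning)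
open import Relation.Nullary using (¬_; yes; no; contradiction)
open import Relation.Nullary.Decidable using (dec-true; dec-false)

-- Domination and the nearest greater element to the left

module Domination {n} (π : Permutation′ n) where

  pos : Fin n → ℕ
  pos i = toℕ (π ⟨$⟩ˡ i)

  pos-injective : ∀ {i j} → pos i ≡ pos j → i ≡ j
  pos-injective eq =
    trans (sym (inverseʳ π))
      (trans (cong (π ⟨$⟩ʳ_) (toℕ-injective eq)) (inverseʳ π))

  pos-<-of-> : ∀ {i k} → i Fin.< k → pos k ≤ pos i → pos k < pos i
  pos-<-of-> i<k le =
    ℕ.≤∧≢⇒< le λ eq → ℕ.<-irrefl (cong toℕ (sym (pos-injective eq))) i<k

  -- nothing is the dummy element.
  place : Maybe (Fin n) → ℕ
  place nothing  = 0
  place (just i) = suc (pos i)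

  value : Maybe (Fin n) → ℕ
  value nothing  = suc n
  value (just i) = suc (toℕ i)

  node : Maybe (Fin n) → Node n
  node nothing  = header
  node (just i) = body i

  toℕ-node : ∀ m → toℕ (node m) ≡ value m
  toℕ-node nothing  = cong suc (toℕ-fromℕ n)
  toℕ-node (just i) = cong suc (toℕ-inject₁ i)

  -- The state of a leftward search from `j`: no dominator of `j` lies to the right of `m`, while
  -- `m` itself need not exceed `j`.
  Candidate : Fin n → Maybe (Fin n) → Set
  Candidate j m = place m < place (just j) ×
                  (∀ k → Dominates π k j → place (just k) ≤ place m)

  NearestGreater : Fin n → Maybe (Fin n) → Set
  NearestGreater j m = value (just j) < value m × Candidate j m

  -- A dominator of `j` exceeds `i`, so it lies strictly left of `i` and dominates `i` too. The
  -- search may thus jump from `i` straight to its nearest greater element.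
  candidate-step : ∀ {i j m} → i Fin.≤ j →
                   Candidate j (just i) → NearestGreater i m → Candidate j m
  candidate-step i≤j (i-left , i-bound) (_ , m-left , m-bound) =
    ℕ.<-trans m-left i-left ,
    λ { k (j<k , k-left) →
        m-bound k ( ℕ.≤-<-trans i≤j j<k
                  , pos-<-of-> (ℕ.≤-<-trans i≤j j<k)
                               (s≤s⁻¹ (i-bound k (j<k , k-left)))) }

  -- A weak inequality, as a vanishing truncated difference yields it, is enough: `m` lies strictly
  -- left of `j`, so the two differ.
  candidate-greater : ∀ {j m} → value (just j) ≤ value m → Candidate j m →
                      NearestGreater j m
  candidate-greater {j} {nothing} _ c = s≤s (toℕ<n j) , c
  candidate-greater {j} {just i} j≤i c@(i-left , _) =
    ℕ.≤∧≢⇒< j≤i (λ eq → ℕ.<-irrefl (cong (place ∘ just)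
                    (sym (toℕ-injective (ℕ.suc-injective eq)))) i-left) , c

  -- An intermediate element would dominate `j` from the right of `i`. A d-dominator larger than `i`
  -- would lie left of `i`, and `i` would separate it from `j`.
  nearestGreater⇒DMax : ∀ {j m} → NearestGreater j m → DMax π j (node m)
  nearestGreater⇒DMax {j} {nothing} (_ , _ , bound) =
    dummy λ i dom → ℕ.n≮0 (bound i dom)
  nearestGreater⇒DMax {j} {just i} (j<i , i-left , bound) =
    greatest ((s≤s⁻¹ j<i , s≤s⁻¹ i-left) ,
              λ { (k , (_ , i<k) , dom) → ℕ.<⇒≱ i<k (s≤s⁻¹ (bound k dom)) })
      λ { k (dom , direct) → ℕ.≮⇒≥ λ i<k →
            direct (i , (i<k , pos-<-of-> i<k (s≤s⁻¹ (bound k dom)))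
                      , (s≤s⁻¹ j<i , s≤s⁻¹ i-left)) }

  elementAt : ∀ {q} → q < n → ∃[ k ] pos k ≡ q
  elementAt q<n =
    π ⟨$⟩ʳ fromℕ< q<n , trans (cong toℕ (inverseˡ π)) (toℕ-fromℕ< q<n)

  nearestGreater : ∀ j → ∃[ m ] NearestGreater j m
  nearestGreater j = search (pos j) ℕ.≤-refl λ _ → proj₂
    where
    -- The positions from `q` on are ruled out; the search ends at the first greater element or, at
    -- `q = 0`, with the dummy.
    search : ∀ q → q ≤ pos j → (∀ k → Dominates π k j → pos k < q) →
             ∃[ m ] NearestGreater j m
    search zero    _     bound =
      nothing , candidate-greater (s≤s (ℕ.<⇒≤ (toℕ<n j))) (s≤s z≤n , bound)
    search (suc q) q<pos bound
      with elementAt (ℕ.<-trans q<pos (toℕ<n (π ⟨$⟩ˡ j)))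
    ... | k , pos≡q with toℕ j ℕ.<? toℕ k
    ...   | yes j<k = just k , s≤s j<k , s≤s (subst (_< pos j) (sym pos≡q) q<pos) ,
                      λ i dom → subst (pos i <_) (cong suc (sym pos≡q)) (bound i dom)
    ...   | no  j≮k =
      search q (ℕ.<⇒≤ q<pos) λ { i dom@(j<i , _) →
        ℕ.≤∧≢⇒< (s≤s⁻¹ (bound i dom)) λ eq →
          j≮k (subst (j Fin.<_) (pos-injective (trans eq (sym pos≡q))) j<i) }

  -- Two proper elements both dominate `j`, so each bounds the position of the other; any dominator
  -- excludes the dummy.
  nearestGreater-unique : ∀ {j m m′} → NearestGreater j m → NearestGreater j m′ →
                          m ≡ m′
  nearestGreater-unique {m = nothing} {nothing} _ _ = refl
  nearestGreater-unique {m = nothing} {just i} (_ , _ , bound) (j<i , i-left , _) =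
    contradiction (bound i (s≤s⁻¹ j<i , s≤s⁻¹ i-left)) ℕ.n≮0
  nearestGreater-unique {m = just i} {nothing} (j<i , i-left , _) (_ , _ , bound) =
    contradiction (bound i (s≤s⁻¹ j<i , s≤s⁻¹ i-left)) ℕ.n≮0
  nearestGreater-unique {m = just i} {just i′}
    (j<i , i-left , bound) (j<i′ , i′-left , bound′) =
    cong just (pos-injective (ℕ.suc-injective (ℕ.≤-antisym
      (bound′ i (s≤s⁻¹ j<i , s≤s⁻¹ i-left))
      (bound i′ (s≤s⁻¹ j<i′ , s≤s⁻¹ i′-left)))))

  prev : Fin n → Maybe (Fin n)
  prev j = proj₁ (nearestGreater j)

  DMax-exists : ∀ j → ∃[ m ] DMax π j m
  DMax-exists j = node (prev j) , nearestGreater⇒DMax (proj₂ (nearestGreater j))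

  DMax-unique : ∀ {j m m′} → DMax π j m → DMax π j m′ → m ≡ m′
  DMax-unique (greatest d bound) (greatest d′ bound′) =
    cong body (toℕ-injective (ℕ.≤-antisym (bound′ _ d) (bound _ d′)))
  DMax-unique (greatest (dom , _) _) (dummy none) = contradiction dom (none _)
  DMax-unique (dummy none) (greatest (dom , _) _) = contradiction dom (none _)
  DMax-unique (dummy _) (dummy _) = refl

  DMax-above : ∀ {j m} → DMax π j m → body j Fin.< m
  DMax-above {j} (greatest {i} ((j<i , _) , _) _) =
    subst₂ _<_ (sym (toℕ-node (just j))) (sym (toℕ-node (just i))) (s≤s j<i)
  DMax-above {j} (dummy _) =
    subst₂ _<_ (sym (toℕ-node (just j))) (sym (toℕ-node nothing)) (s≤s (toℕ<n j))

-- The flow-graph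

module FlowGraph {n} (π : Permutation′ n) where

  open Domination π

  header≢body : ∀ {i : Fin n} → header ≢ body i
  header≢body {i} eq = ℕ.<-irrefl
    (trans (sym (toℕ-node (just i))) (trans (cong toℕ (sym eq)) (toℕ-node nothing)))
    (s≤s (toℕ<n i))

  -- Forward edges suffice. The recursion is on the index, since `inject₁ i` is not structurally
  -- smaller than `suc i`.
  descend : ∀ {v w} → toℕ w ≤ toℕ v → Star F[ π ] v w
  descend {v} {w} w≤v = go (toℕ v) refl w≤v
    where
    go : ∀ k {v} → toℕ v ≡ k → toℕ w ≤ k → Star F[ π ] v w
    go k {v} eq w≤k with toℕ v ℕ.≟ toℕ w
    go k       eq w≤k | yes v≡w with refl ← toℕ-injective v≡w = ε
    go zero    {zero}  eq w≤k | no v≢w = contradiction (sym (ℕ.n≤0⇒n≡0 w≤k)) v≢w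
    go (suc k) {suc i} eq w≤k | no v≢w =
      forward i ◅ go k (trans (toℕ-inject₁ i) (ℕ.suc-injective eq))
                       (s≤s⁻¹ (ℕ.≤∧≢⇒< w≤k λ w≡k → v≢w (trans eq (sym w≡k))))

  edge-drop : ∀ {v w} → F[ π ] v w → toℕ v ≤ suc (toℕ w)
  edge-drop (forward i)    = s≤s (ℕ.≤-reflexive (sym (toℕ-inject₁ i)))
  edge-drop (backward i d) = ℕ.≤-trans (ℕ.<⇒≤ (DMax-above d)) (ℕ.n≤1+n _)

  -- The path starts at or above `y′`, ends below it and sinks by at most one per edge, so it visits
  -- `y′`. It then leaves `y′` by an edge, which is possible only outside `H`.
  first-entry-highest : ∀ {H : Subset (2 + n)} {v y y′} →
    Star (λ a b → a ∉ H × F[ π ] a b) v y → toℕ y < toℕ y′ → toℕ y′ ≤ toℕ v → y′ ∉ H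
  first-entry-highest ε y<y′ y′≤y = contradiction y′≤y (ℕ.<⇒≱ y<y′)
  first-entry-highest {v = v} {y′ = y′} ((v∉H , e) ◅ es) y<y′ y′≤v with toℕ y′ ℕ.≟ toℕ v
  ... | yes y′≡v with refl ← toℕ-injective y′≡v = v∉H
  ... | no  y′≢v = first-entry-highest es y<y′
                     (s≤s⁻¹ (ℕ.≤-trans (ℕ.≤∧≢⇒< y′≤v y′≢v) (edge-drop e)))

  ≤-header : ∀ (v : Node n) → toℕ v ≤ toℕ (header {n})
  ≤-header v = subst (toℕ v ≤_) (sym (toℕ-fromℕ (suc n))) (s≤s⁻¹ (toℕ<n v))

  F-reducible : Reducible header F[ π ]
  F-reducible (H , _ , y , y′ , y≢y′ , (y∈H , path) , (y′∈H , path′))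
    with ℕ.<-cmp (toℕ y) (toℕ y′)
  ... | tri< y<y′ _ _ = first-entry-highest path  y<y′ (≤-header y′) y′∈H
  ... | tri≈ _ y≡y′ _ = y≢y′ (toℕ-injective y≡y′)
  ... | tri> _ _ y′<y = first-entry-highest path′ y′<y (≤-header y)  y∈H

  -- With `header` itself as the source, matching on `backward` would get stuck at `inject₁ i`
  -- against `fromℕ n`.
  header-successor : ∀ {v w} → v ≡ header → F[ π ] v w → inject₁ (fromℕ n) ≡ w
  header-successor eq (forward i)    with refl ← eq = refl
  header-successor eq (backward i _) = contradiction (sym eq) header≢body

  body-successor : ∀ {v w i m} → v ≡ body i → DMax π i m → F[ π ] v w →
                   w ≡ below-body i ⊎ w ≡ m
  body-successor eq d (forward i)     with refl ← eq = inj₁ refl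
  body-successor eq d (backward i′ d′)
    with refl ← toℕ-injective (ℕ.suc-injective
                  (trans (sym (toℕ-node (just i′))) (trans (cong toℕ eq) (toℕ-node (just _)))))
    = inj₂ (DMax-unique d′ d)

  isReduciblePermutationFlowGraph : IsReduciblePermutationFlowGraph F[ π ]
  isReduciblePermutationFlowGraph = record
    { source         = λ v → descend (≤-header v)
    ; reducible      = F-reducible
    ; header-degree  = inject₁ (fromℕ n) , forward (fromℕ n) , λ _ → header-successor refl
    ; footer-degree  = λ _ ()
    ; footer-reached = λ _ → descend z≤n
    ; body-degree    = λ i → let m , d = DMax-exists i in
        m , DMax-above d , λ w → mk⇔ (body-successor refl d)
          λ { (inj₁ refl) → forward (inject₁ i) ; (inj₂ refl) → backward i d }
    }

-- Running programs with time credits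

-- A total-correctness triple in which the unspent credits `rest` are passed on to `Q`. As `Q` may
-- be `Halts` of the remaining program, proofs follow the execution.
record Halts (p : Program) (t : ℕ) (σ : Store) (Q : ℕ → Store → Set) : Set where
  constructor halts
  field
    {trace} : Trace
    {final} : Store
    {rest}  : ℕ
    run     : Run p σ trace final
    bound   : timeOf trace + rest ≤ t
    post    : Q rest final

weaken : ∀ {p t t′ σ Q} → t ≤ t′ → Halts p t σ Q → Halts p t′ σ Q
weaken t≤t′ (halts run bound post) = halts run (ℕ.≤-trans bound t≤t′) post

step : ∀ {c t σ} {Q : ℕ → Store → Set} → Q t (apply c σ) → Halts (instr c) (suc t) σ Q
step post = halts instr ℕ.≤-refl post

sequence : ∀ {a b c} (τ₁ : Trace) {τ₂ : Trace} → timeOf τ₁ + a ≤ c → timeOf τ₂ + b ≤ a →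
           timeOf (τ₁ ++ τ₂) + b ≤ c
sequence {a} {b} {c} τ₁ {τ₂} bound₁ bound₂ = begin
  timeOf (τ₁ ++ τ₂) + b        ≡⟨ cong (_+ b) (length-++ τ₁) ⟩
  timeOf τ₁ + timeOf τ₂ + b    ≡⟨ ℕ.+-assoc (timeOf τ₁) (timeOf τ₂) b ⟩
  timeOf τ₁ + (timeOf τ₂ + b)  ≤⟨ ℕ.+-monoʳ-≤ (timeOf τ₁) bound₂ ⟩
  timeOf τ₁ + a                ≤⟨ bound₁ ⟩
  c                            ∎
  where open ℕ.≤-Reasoning

seq : ∀ {p q t σ Q} → Halts p t σ (λ u σ′ → Halts q u σ′ Q) → Halts (p ⨾ q) t σ Q
seq (halts {τ₁} run₁ bound₁ (halts run₂ bound₂ post)) =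
  halts (run₁ ⨾ run₂) (sequence τ₁ bound₁ bound₂) post

while-stop : ∀ {r p t σ} {Q : ℕ → Store → Set} →
             σ (reg r) ≡ 0 → Q t σ → Halts (while r p) (suc t) σ Q
while-stop r≡0 post = halts (while-false r≡0) ℕ.≤-refl post

while-next : ∀ {r p t σ Q} → σ (reg r) ≢ 0 →
             Halts p t σ (λ u σ′ → Halts (while r p) u σ′ Q) →
             Halts (while r p) (suc t) σ Q
while-next r≢0 (halts {τ₁} run₁ bound₁ (halts run₂ bound₂ post)) =
  halts (while-true r≢0 run₁ run₂) (s≤s (sequence τ₁ bound₁ bound₂)) post

-- `I k` is the invariant with `k` iterations left. An iteration costs `s` plus one test, and the
-- outer `suc` pays the failing test. The body rule holds for every `R`, so the rest of the loop can
-- take its place.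
countdown : ∀ {r p s t Q} (I : ℕ → Store → Set) →
  (∀ {k σ} → I k σ → σ (reg r) ≡ k) →
  (∀ {k σ u} {R : ℕ → Store → Set} →
     I (suc k) σ → (∀ {σ′} → I k σ′ → R u σ′) → Halts p (s + u) σ R) →
  ∀ k {σ} → I k σ → (∀ {σ′} → I 0 σ′ → Q t σ′) →
  Halts (while r p) (suc (k * suc s + t)) σ Q
countdown I counter iterate zero i post = while-stop (counter i) (post i)
countdown {s = s} {t} I counter iterate (suc k) i post =
  while-next (λ r≡0 → ℕ.1+n≢0 (trans (sym (counter i)) r≡0))
    (weaken (ℕ.≤-reflexive (trans (ℕ.+-suc s _) (cong suc (sym (ℕ.+-assoc s _ t)))))
      (iterate i λ i′ → countdown I counter iterate k i′ post))

-- Reading a cell after a write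

update-same : ∀ σ {c d} v → c ≡ d → update σ c v d ≡ v
update-same σ {c} {d} v c≡d rewrite dec-true (c ≟ d) c≡d = refl

update-other : ∀ σ {c d} v → c ≢ d → update σ c v d ≡ σ d
update-other σ {c} {d} v c≢d rewrite dec-false (c ≟ d) c≢d = refl

write-same : ∀ σ a {i j} v → i ≡ j → update σ (arr a i) v (arr a j) ≡ v
write-same σ a {i} {j} v i≡j = update-same σ {arr a i} {arr a j} v (cong (arr a) i≡j)

write-other : ∀ σ a {i j} v → i ≢ j → update σ (arr a i) v (arr a j) ≡ σ (arr a j)
write-other σ a {i} {j} v i≢j =
  update-other σ {arr a i} {arr a j} v λ { refl → i≢j refl }

-- Space bounded in terms of time

accessed-≤3 : ∀ c σ → length (accessed c σ) ≤ 3
accessed-≤3 (const _ _)   _ = s≤s z≤n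
accessed-≤3 (copy _ _)    _ = s≤s (s≤s z≤n)
accessed-≤3 (add _ _ _)   _ = ℕ.≤-refl
accessed-≤3 (sub _ _ _)   _ = ℕ.≤-refl
accessed-≤3 (load _ _ _)  _ = ℕ.≤-refl
accessed-≤3 (store _ _ _) _ = ℕ.≤-refl

run-accesses-≤3 : ∀ {p σ τ σ′} → Run p σ τ σ′ → All (λ e → length e ≤ 3) τ
run-accesses-≤3 {σ = σ} (instr {c}) = accessed-≤3 c σ ∷ []
run-accesses-≤3 (run₁ ⨾ run₂)    = ++⁺ (run-accesses-≤3 run₁) (run-accesses-≤3 run₂)
run-accesses-≤3 (if-true _ run)  = s≤s z≤n ∷ run-accesses-≤3 run
run-accesses-≤3 (if-false _ run) = s≤s z≤n ∷ run-accesses-≤3 run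
run-accesses-≤3 (while-true _ run₁ run₂) =
  s≤s z≤n ∷ ++⁺ (run-accesses-≤3 run₁) (run-accesses-≤3 run₂)
run-accesses-≤3 (while-false _)  = s≤s z≤n ∷ []

length-concat-≤ : ∀ {τ} → All (λ e → length e ≤ 3) τ → length (concat τ) ≤ timeOf τ * 3
length-concat-≤ [] = z≤n
length-concat-≤ {e ∷ τ} (le ∷ les) =
  ℕ.≤-trans (ℕ.≤-reflexive (length-++ e)) (ℕ.+-mono-≤ le (length-concat-≤ les))

space≤3*time : ∀ {p σ τ σ′} → Run p σ τ σ′ → spaceOf τ ≤ timeOf τ * 3
space≤3*time {τ = τ} run =
  ℕ.≤-trans (length-deduplicate _≟_ (concat τ)) (length-concat-≤ (run-accesses-≤3 run))

-- Computing dmax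

pattern rTop  = 6    -- top of the stack
pattern rX    = 7
pattern rDiff = 8
pattern rRest = 9    -- number of positions left

-- `rDiff` is nonzero exactly while the top is below the scanned element; the dummy, having value n
-- + 1, always stops the loop.
pop : Program
pop = while rDiff
  ( instr (load rTop aP rTop) ⨾
    instr (sub rDiff rX rTop) )

scan : Program
scan = while rRest
  ( instr (load rX aπ rI) ⨾
    instr (sub rDiff rX rTop) ⨾
    pop ⨾
    instr (store aP rX rTop) ⨾
    instr (copy rTop rX) ⨾
    instr (add rI rI rOne) ⨾
    instr (sub rRest rRest rOne) )

step₁ : Program
step₁ =
  instr (const rOne 1) ⨾
  instr (copy rRest rLength) ⨾
  instr (add rTop rLength rOne) ⨾
  instr (copy rI rOne) ⨾
  scan

exchange : ∀ a b c → a + (b + c) ≡ b + (a + c)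
exchange = solve-∀

-- Of the 11 credits per position, 3 pay the load, the subtraction and the failing test of `pop`.
-- The other 8 pay four instructions, the deposit of 3 and the next test of `scan`.
body-credits : ∀ b c → 3 + (b + (8 + c)) ≡ b + (11 + c)
body-credits = solve-∀

module DMaxAlgorithm {n} (π : Permutation′ n) where

  open Domination π

  -- The chain of iterated `prev` from the top down to the dummy. Its length serves as the potential
  -- of the amortised analysis.
  data Stack : Maybe (Fin n) → ℕ → Set where
    []   : Stack nothing 0
    push : ∀ {i ℓ} → Stack (prev i) ℓ → Stack (just i) (suc ℓ)

  -- The first p positions are processed and k positions are left.
  Scanned : (p k : ℕ) → Store → Set
  Scanned p k σ =
    StoresPermutation π σ × σ (reg rOne) ≡ 1 × σ (reg rRest) ≡ k × σ (reg rI) ≡ suc p ×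
    (∀ j → pos j < p → σ (arr aP (suc (toℕ j))) ≡ value (prev j))

  -- Every push deposits the 3 credits that the pop of the same element spends.
  pop-halts : ∀ {p k x m ℓ t σ Q} → pos x ≡ p → Scanned p k σ →
    σ (reg rX) ≡ suc (toℕ x) → σ (reg rTop) ≡ value m →
    σ (reg rDiff) ≡ suc (toℕ x) ∸ value m → Candidate x m → Stack m ℓ →
    (∀ {ℓ′ σ′} → Scanned p k σ′ → σ′ (reg rX) ≡ suc (toℕ x) →
       σ′ (reg rTop) ≡ value (prev x) → Stack (prev x) ℓ′ → Q (ℓ′ * 3 + t) σ′) →
    Halts pop (suc (ℓ * 3 + t)) σ Q
  pop-halts {x = x} {m} pos≡p inv xEq topEq diffEq c stack post
    with suc (toℕ x) ℕ.≤? value m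
  ... | yes x≤m
      -- The first top not below `x` is `prev x`.
      with refl ← nearestGreater-unique (candidate-greater x≤m c) (proj₂ (nearestGreater x)) =
    while-stop (trans diffEq (ℕ.m≤n⇒m∸n≡0 x≤m)) (post inv xEq topEq stack)
  pop-halts {x = x} _ _ _ _ _ _ [] _ | no x≰m = contradiction (s≤s (ℕ.<⇒≤ (toℕ<n x))) x≰m
  pop-halts {x = x} {σ = σ} refl inv@(_ , _ , _ , _ , done) xEq topEq diffEq c (push {i} stack) post
      | no x≰m =
    while-next (λ diff≡0 → x≰m (ℕ.m∸n≡0⇒m≤n (trans (sym diffEq) diff≡0)))
      (seq (step (step (pop-halts refl inv xEq topEq′ (cong₂ _∸_ xEq topEq′)
        (candidate-step (ℕ.<⇒≤ (s≤s⁻¹ (ℕ.≰⇒> x≰m))) c (proj₂ (nearestGreater i))) stack post))))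
    where
    topEq′ : σ (arr aP (σ (reg rTop))) ≡ value (prev i)
    -- The top lies left of `x`, so its entry in `aP` has already been written.
    topEq′ = trans (cong (σ ∘ arr aP) topEq) (done i (s≤s⁻¹ (proj₁ c)))

  -- As `place` counts from 1, `place m ≡ p` makes the top the last scanned element or, for `p = 0`,
  -- the dummy.
  scan-halts : ∀ k {p m ℓ t σ Q} → p + k ≡ n → Scanned p k σ → σ (reg rTop) ≡ value m →
    place m ≡ p → Stack m ℓ →
    (∀ {u σ′} → t ≤ u → StoresDMax π σ′ → Q u σ′) →
    Halts scan (suc (ℓ * 3 + (k * 11 + t))) σ Q
  scan-halts zero {p} {ℓ = ℓ} {σ = σ} p+0≡n ((lengthEq , _) , _ , restEq , _ , done) _ _ _ post =
    -- The deposits of elements never popped remain as surplus, so at least `t` credits are left.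
    while-stop restEq (post (ℕ.m≤n+m _ (ℓ * 3)) (lengthEq , λ j →
      node (prev j) , nearestGreater⇒DMax (proj₂ (nearestGreater j)) ,
      trans (done j (subst (pos j <_) n≡p (toℕ<n (π ⟨$⟩ˡ j)))) (sym (toℕ-node (prev j)))))
    where
    n≡p : n ≡ p
    n≡p = trans (sym p+0≡n) (ℕ.+-identityʳ p)
  scan-halts (suc k) {p} {m} {ℓ} {t} {σ} {Q} p+k≡n
    inv@((_ , input) , _ , restEq , indexEq , _) topEq placeEq stack post =
    while-next (λ rest≡0 → ℕ.1+n≢0 (trans (sym restEq) rest≡0))
      (weaken (ℕ.≤-reflexive (body-credits (ℓ * 3) (k * 11 + t)))
        (seq (step (seq (step (seq (pop-halts pos≡p inv xEq topEq (cong₂ _∸_ xEq topEq)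
          candidate stack λ {ℓ′} inv′ xEq′ topEq′ stack′ →
            weaken (ℕ.≤-reflexive (exchange 8 (ℓ′ * 3) (k * 11 + t)))
              (finish inv′ xEq′ topEq′ stack′))))))))
    where
    p<n : p < n
    p<n = subst (p <_) p+k≡n (ℕ.m<m+n p (s≤s z≤n))
    x = proj₁ (elementAt p<n)
    pos≡p : pos x ≡ p
    pos≡p = proj₂ (elementAt p<n)
    xEq : σ (arr aπ (σ (reg rI))) ≡ suc (toℕ x)
    xEq = trans (cong (σ ∘ arr aπ) (trans indexEq (cong suc (sym pos≡p))))
                (trans (input (π ⟨$⟩ˡ x)) (cong (suc ∘ toℕ) (inverseʳ π)))
    candidate : Candidate x m
    -- The top is the left neighbour of `x`, or the dummy, so nothing lies between them.
    candidate = s≤s (ℕ.≤-reflexive (trans placeEq (sym pos≡p))) ,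
                λ { i (_ , i-left) → ℕ.≤-trans i-left (ℕ.≤-reflexive (trans pos≡p (sym placeEq))) }
    finish : ∀ {ℓ′ σ′} → Scanned p (suc k) σ′ → σ′ (reg rX) ≡ suc (toℕ x) →
      σ′ (reg rTop) ≡ value (prev x) → Stack (prev x) ℓ′ →
      Halts ( instr (store aP rX rTop) ⨾ instr (copy rTop rX) ⨾
              instr (add rI rI rOne) ⨾ instr (sub rRest rRest rOne) )
            (8 + (ℓ′ * 3 + (k * 11 + t))) σ′ (λ u σ″ → Halts scan u σ″ Q)
    finish {σ′ = σ′} (input′ , oneEq′ , restEq′ , indexEq′ , done′) xEq′ topEq′ stack′ =
      seq (step (seq (step (seq (step (step
        (scan-halts k (trans (sym (ℕ.+-suc p k)) p+k≡n)
          ( input′ , oneEq′ , cong₂ _∸_ restEq′ oneEq′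
          , trans (cong₂ _+_ indexEq′ oneEq′) (ℕ.+-comm (suc p) 1)
          , done″ )
          xEq′ (cong suc pos≡p) (push stack′) post)))))))
      where
      done″ : ∀ j → pos j < suc p →
        update σ′ (arr aP (σ′ (reg rX))) (σ′ (reg rTop)) (arr aP (suc (toℕ j))) ≡ value (prev j)
      done″ j j≤p with pos j ℕ.≟ p
      ... | yes pos-j≡p with refl ← pos-injective (trans pos-j≡p (sym pos≡p)) =
        trans (write-same σ′ aP _ xEq′) topEq′
      ... | no pos-j≢p =
        trans (write-other σ′ aP _ λ eq → pos-j≢p (trans (cong pos (sym (x≡j eq))) pos≡p))
              (done′ j (ℕ.≤∧≢⇒< (s≤s⁻¹ j≤p) pos-j≢p))
        where
        x≡j : σ′ (reg rX) ≡ suc (toℕ j) → x ≡ j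
        x≡j eq = toℕ-injective (ℕ.suc-injective (trans (sym xEq′) eq))

  step₁-halts : ∀ {t σ Q} → StoresPermutation π σ →
    (∀ {u σ′} → t ≤ u → StoresDMax π σ′ → Q u σ′) →
    Halts step₁ (5 + (n * 11 + t)) σ Q
  step₁-halts input@(lengthEq , _) post =
    seq (step (seq (step (seq (step (seq (step
      (scan-halts n refl (input , refl , lengthEq , refl , λ _ ())
        (trans (cong (_+ 1) lengthEq) (ℕ.+-comm n 1)) refl [] post))))))))

-- Constructing the graph

addEdgeIJ : Store → Store
addEdgeIJ σ = apply (add rEdges rEdges rOne)
                (apply (store aTarget rEdges rJ) (apply (store aSource rEdges rI) σ))

edgeList-addEdge : ∀ σ → σ (reg rOne) ≡ 1 →
                   edgeList (addEdgeIJ σ) ≡ edgeList σ ++ [ σ (reg rI) , σ (reg rJ) ]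
edgeList-addEdge σ oneEq = begin
  map edge′ (upTo (e + σ (reg rOne)))
    ≡⟨ cong (map edge′ ∘ upTo) (trans (cong (e +_) oneEq) (ℕ.+-comm e 1)) ⟩
  map edge′ (upTo (suc e))
    ≡⟨ cong (map edge′) (sym (upTo-∷ʳ e)) ⟩
  map edge′ (upTo e ++ [ e ])
    ≡⟨ map-++ edge′ (upTo e) [ e ] ⟩
  map edge′ (upTo e) ++ [ edge′ e ]
    ≡⟨ cong₂ _++_ (map-cong-local (All.map old (all-upTo e))) (cong [_] new) ⟩
  edgeList σ ++ [ σ (reg rI) , σ (reg rJ) ] ∎
  where
  open ≡-Reasoning
  e : ℕ
  e = σ (reg rEdges)
  edge edge′ : ℕ → ℕ × ℕ
  edge  d = σ (arr aSource d) , σ (arr aTarget d)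
  edge′ d = addEdgeIJ σ (arr aSource d) , addEdgeIJ σ (arr aTarget d)
  old : ∀ {d} → d < e → edge′ d ≡ edge d
  old {d} d<e = cong₂ _,_
    (write-other σ aSource {e} {d} (σ (reg rI)) (ℕ.>⇒≢ d<e))
    (write-other σ aTarget {e} {d} (σ (reg rJ)) (ℕ.>⇒≢ d<e))
  new : edge′ e ≡ (σ (reg rI) , σ (reg rJ))
  new = cong₂ _,_ (write-same σ aSource {e} {e} (σ (reg rI)) refl)
                  (write-same σ aTarget {e} {e} (σ (reg rJ)) refl)

-- Both construction loops keep the written edges followed by the pending ones equal to a fixed
-- list; an iteration moves one edge across.
edgeList-∷ : ∀ {σ i j es L} → σ (reg rOne) ≡ 1 → σ (reg rI) ≡ i → σ (reg rJ) ≡ j →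
             edgeList σ ++ (i , j) ∷ es ≡ L → edgeList (addEdgeIJ σ) ++ es ≡ L
edgeList-∷ {σ} {es = es} oneEq refl refl eq =
  trans (cong (_++ es) (edgeList-addEdge σ oneEq))
    (trans (++-assoc (edgeList σ) [ _ ] es) eq)

forwardEdges : ℕ → List (ℕ × ℕ)
forwardEdges k = map (λ i → suc i , i) (downFrom k)

backwardEdges : (ℕ → ℕ) → ℕ → List (ℕ × ℕ)
backwardEdges P k = map (λ i → suc i , P (suc i)) (downFrom k)

-- `P` tracks the contents of `aP`, which must survive until the backward edges are written. The 5
-- covers four instructions and the last test, the 6 one test and five instructions.
step₂-halts : ∀ {n} {P : ℕ → ℕ} {t σ Q} → σ (reg rLength) ≡ n → (∀ i → σ (arr aP i) ≡ P i) →
  (∀ {σ′} → σ′ (reg rLength) ≡ n → (∀ i → σ′ (arr aP i) ≡ P i) → σ′ (reg rOne) ≡ 1 →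
     σ′ (reg rNodes) ≡ 2 + n → edgeList σ′ ≡ forwardEdges (suc n) → Q t σ′) →
  Halts step₂ (5 + (suc n * 6 + t)) σ Q
step₂-halts {n} {P} {t} {σ} {Q} lengthEq P-eq post =
  seq (step (seq (step (seq (step (seq (step
    (countdown {t = t} {Q = Q} I proj₁
      (λ { {σ = σ} (iEq , oneEq , lengthEq , P-eq , nodesEq , edgesEq) continue →
        let jEq = cong₂ _∸_ iEq oneEq in
        seq (step (seq (seq (step (seq (step (step (step (continue
          ( jEq , oneEq , lengthEq , P-eq , nodesEq
          , edgeList-∷ {apply (sub rJ rI rOne) σ} oneEq iEq jEq edgesEq )))))))))) })
      (suc n)
      (iEq₀ , refl , lengthEq , P-eq , trans (cong (_+ 1) iEq₀) (ℕ.+-comm (suc n) 1) , refl)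
      λ { (_ , oneEq , lengthEq , P-eq , nodesEq , edgesEq) →
        post lengthEq P-eq oneEq nodesEq (trans (sym (++-identityʳ _)) edgesEq) }))))))))
  where
  iEq₀ : σ (reg rLength) + 1 ≡ suc n
  iEq₀ = trans (cong (_+ 1) lengthEq) (ℕ.+-comm n 1)
  I : ℕ → Store → Set
  I k σ = σ (reg rI) ≡ k × σ (reg rOne) ≡ 1 × σ (reg rLength) ≡ n ×
          (∀ i → σ (arr aP i) ≡ P i) × σ (reg rNodes) ≡ 2 + n ×
          edgeList σ ++ forwardEdges k ≡ forwardEdges (suc n)

step₃-halts : ∀ {n} {P : ℕ → ℕ} {N L t σ Q} → σ (reg rLength) ≡ n → (∀ i → σ (arr aP i) ≡ P i) →
  σ (reg rOne) ≡ 1 → σ (reg rNodes) ≡ N → edgeList σ ≡ L →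
  (∀ {σ′} → σ′ (reg rNodes) ≡ N → edgeList σ′ ≡ L ++ backwardEdges P n → Q t σ′) →
  Halts step₃ (2 + (n * 6 + t)) σ Q
step₃-halts {n} {P} {N} {L} {t} {Q = Q} lengthEq P-eq oneEq nodesEq edgesEq post =
  seq (step (countdown {t = t} {Q = Q} I proj₁
    (λ { {σ = σ} (iEq , oneEq , P-eq , nodesEq , edgesEq) continue →
      seq (step (seq (seq (step (seq (step (step (step (continue
        ( cong₂ _∸_ iEq oneEq , oneEq , P-eq , nodesEq
        , edgeList-∷ {apply (load rJ aP rI) σ} oneEq iEq
            (trans (P-eq _) (cong P iEq)) edgesEq )))))))))) })
    n
    (lengthEq , oneEq , P-eq , nodesEq , cong (_++ backwardEdges P n) edgesEq)
    λ { (_ , _ , _ , nodesEq , edgesEq) →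
      post nodesEq (trans (sym (++-identityʳ _)) edgesEq) }))
  where
  I : ℕ → Store → Set
  I k σ = σ (reg rI) ≡ k × σ (reg rOne) ≡ 1 × (∀ i → σ (arr aP i) ≡ P i) ×
          σ (reg rNodes) ≡ N ×
          edgeList σ ++ backwardEdges P k ≡ L ++ backwardEdges P n

-- Correctness of the whole encoding

module _ {n} (π : Permutation′ n) where

  open Domination π

  edgeList⇒StoresGraph : ∀ {P : ℕ → ℕ} {σ} →
    (∀ i → ∃[ m ] DMax π i m × P (suc (toℕ i)) ≡ toℕ m) →
    σ (reg rNodes) ≡ 2 + n →
    edgeList σ ≡ forwardEdges (suc n) ++ backwardEdges P n →
    StoresGraph F[ π ] σ
  edgeList⇒StoresGraph {P} {σ} P-dmax nodesEq edgesEq = record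
    { nodes    = nodesEq
    ; unique   = subst Unique (sym edgesEq) (Unique.++⁺
                   (Unique.map⁺ (ℕ.suc-injective ∘ cong proj₁) (Unique.downFrom⁺ (suc n)))
                   (Unique.map⁺ (ℕ.suc-injective ∘ cong proj₁) (Unique.downFrom⁺ n))
                   λ { (fwd , bwd) → disjoint (∈-map⁻ _ fwd) (∈-map⁻ _ bwd) })
    ; sound    = λ xy∈ → sound (∈-++⁻ (forwardEdges (suc n)) (subst (_ ∈ˡ_) edgesEq xy∈))
    ; complete = λ e → subst (_ ∈ˡ_) (sym edgesEq) (complete e)
    }
    where
    below : ∀ {k i} → (∃[ j ] j ∈ˡ downFrom k × i ≡ j) → i < k
    below (_ , j∈ , refl) = ∈-downFrom⁻ j∈

    P-value : ∀ {i} → i < n → ∃₂ λ j m → toℕ j ≡ i × DMax π j m × P (suc i) ≡ toℕ m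
    P-value i<n with P-dmax (fromℕ< i<n)
    ... | m , d , eq = fromℕ< i<n , m , toℕ-fromℕ< i<n , d ,
                       trans (cong (P ∘ suc) (sym (toℕ-fromℕ< i<n))) eq

    -- A common edge would have a target both below its source and, being a dmax value, above it.
    disjoint : ∀ {e} → ∃[ i ] i ∈ˡ downFrom (suc n) × e ≡ (suc i , i) →
               ¬ (∃[ i ] i ∈ˡ downFrom n × e ≡ (suc i , P (suc i)))
    disjoint (i , _ , refl) (j , j∈ , eq)
      with refl ← ℕ.suc-injective (cong proj₁ eq) | P-value (∈-downFrom⁻ j∈)
    ... | k , m , refl , d , P≡m = ℕ.<⇒≱ (DMax-above d)
      (ℕ.≤-trans (ℕ.≤-reflexive (trans (sym P≡m) (sym (cong proj₂ eq))))
        (ℕ.≤-trans (ℕ.n≤1+n _) (ℕ.≤-reflexive (sym (toℕ-node (just k))))))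

    sound : ∀ {x y} → (x , y) ∈ˡ forwardEdges (suc n) ⊎ (x , y) ∈ˡ backwardEdges P n →
            ∃₂ λ v w → toℕ v ≡ x × toℕ w ≡ y × F[ π ] v w
    sound (inj₁ fwd) with i , i∈ , refl ← ∈-map⁻ _ fwd =
      let i<1+n = ∈-downFrom⁻ i∈ in
      _ , _ , cong suc (toℕ-fromℕ< i<1+n) ,
      trans (toℕ-inject₁ _) (toℕ-fromℕ< i<1+n) , forward (fromℕ< i<1+n)
    sound (inj₂ bwd) with i , i∈ , refl ← ∈-map⁻ _ bwd
      with j , m , refl , d , P≡m ← P-value (∈-downFrom⁻ i∈) =
      _ , _ , toℕ-node (just j) , sym P≡m , backward j d

    complete : ∀ {v w} → F[ π ] v w →
               (toℕ v , toℕ w) ∈ˡ forwardEdges (suc n) ++ backwardEdges P n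
    complete (forward i) rewrite toℕ-inject₁ i =
      ∈-++⁺ˡ (∈-map⁺ _ (∈-downFrom⁺ (toℕ<n i)))
    -- Uniqueness of dmax identifies the target of the edge with the stored value.
    complete (backward i d) with m , d′ , P≡m ← P-dmax i
      rewrite DMax-unique d d′ | sym P≡m | toℕ-inject₁ i =
      ∈-++⁺ʳ (forwardEdges (suc n)) (∈-map⁺ _ (∈-downFrom⁺ (toℕ<n i)))

  encode-halts : ∀ {σ} → StoresPermutation π σ →
    Halts (encode-SiP-to-RPG step₁) (5 + (n * 11 + (5 + (suc n * 6 + (2 + (n * 6 + 0))))))
          σ (λ _ → StoresGraph F[ π ])
  encode-halts input =
    seq (DMaxAlgorithm.step₁-halts π input λ { {σ′ = σ₁} t≤u (lengthEq , P-dmax) →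
      weaken t≤u (seq (step₂-halts {P = λ i → σ₁ (arr aP i)} lengthEq (λ _ → refl)
        λ lengthEq P-eq oneEq nodesEq edgesEq →
          step₃-halts lengthEq P-eq oneEq nodesEq edgesEq
            (edgeList⇒StoresGraph {λ i → σ₁ (arr aP i)} P-dmax))) })

-- Linear bounds

time : ℕ → ℕ
time n = 18 + n * 23

linear : ∀ n → 5 + (n * 11 + (5 + (suc n * 6 + (2 + (n * 6 + 0))))) ≡ 18 + n * 23
linear = solve-∀

time-linear : time ∈O (λ n → n)
-- 41 = 18 + 23: from n = 1 on, the constant 18 is at most 18 * n.
time-linear = 41 , 1 , λ { n@(suc _) 1≤n →
  ℕ.≤-trans (ℕ.+-monoˡ-≤ (n * 23) (ℕ.*-monoʳ-≤ 18 1≤n)) (ℕ.≤-reflexive (factor n)) }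
  where
  factor : ∀ n → 18 * n + n * 23 ≡ 41 * n
  factor = solve-∀

*-constant-∈O : ∀ {f g} k → f ∈O g → (λ n → f n * k) ∈O g
*-constant-∈O {f} {g} k (c , n₀ , bound) = k * c , n₀ , λ n n₀≤n → begin
  f n * k        ≤⟨ ℕ.*-monoˡ-≤ k (bound n n₀≤n) ⟩
  c * g n * k    ≡⟨ ℕ.*-comm (c * g n) k ⟩
  k * (c * g n)  ≡⟨ ℕ.*-assoc k c (g n) ⟨
  k * c * g n    ∎
  where open ℕ.≤-Reasoning

theorem3p3 : ∃[ step₁ ] ∃[ time ] ∃[ space ]
    time ∈O (λ n → n) ×
    space ∈O (λ n → n) ×
    (∀ (n : ℕ) (π : Permutation′ n) → SelfInverting π →
    IsReduciblePermutationFlowGraph F[ π ] ×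
    (∀ (σ : Store) → StoresPermutation π σ →
    (∃[ τ ] ∃[ σ₁ ] Run step₁ σ τ σ₁ × StoresDMax π σ₁) ×
    (∃[ τ ] ∃[ σ′ ] Run (encode-SiP-to-RPG step₁) σ τ σ′ ×
    StoresGraph F[ π ] σ′ ×
    timeOf τ ≤ time n ×
    spaceOf τ ≤ space n)))
theorem3p3 =
  step₁ , time , (λ n → time n * 3) , time-linear , *-constant-∈O 3 time-linear ,
  λ n π _ → FlowGraph.isReduciblePermutationFlowGraph π , λ σ input →
    (let halts run _ stored = DMaxAlgorithm.step₁-halts π {t = 0} {Q = λ _ → StoresDMax π}
                                input (λ _ stored → stored)
     in _ , _ , run , stored) ,
    (let halts {τ} run bound stored = encode-halts π input
         inTime = ℕ.m+n≤o⇒m≤o (timeOf τ) (ℕ.≤-trans bound (ℕ.≤-reflexive (linear n)))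
     in _ , _ , run , stored , inTime ,
        ℕ.≤-trans (space≤3*time run) (ℕ.*-monoˡ-≤ 3 inTime))
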